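{- On every input $(P,p_0)$, the algorithm \texttt{FlipTour} always reaches a local optimum (a tour whose optimal trajectory cannot be improved by inverting a subtour) after calling the oracle at most $O(n^3L)$ many times, where $n$ is the number of cities and $L$ is the maximum distance (in a dimension) between two cities.
   Context: Racetrack model. Fix a dimension $d$. A configuration $c$ consists of a position $pos(c)\in\mathbb{Z}^d$ and a velocity $vel(c)\in\mathbb{Z}^d$. A configuration $c'$ is a successor of $c$ if every coordinate of $vel(c')-vel(c)$ has absolute value at most $1$ and $pos(c')=pos(c)+vel(c')$. A trajectory is a finite sequence of configurations $(c_1,\dots,c_k)$ in which $c_{i+1}$ is a successor of $c_i$ for all $i<k$; its cost (length) is $k$. A point $p$ is visited by a configuration $c$ if it lies on the segment between $p_a=pos(c)-vel(c)$ and $pos(c)$; several cities visited by the same configuration are considered visited in increasing order of distance from $p_a$. It is allowed to pass over a city without counting this as its visit. The input is a set $P\subseteq\mathbb{Z}^d$ of $n$ cities and a starting city $p_0\in P$; $L=\max_{p,q\in P}\|p-q\|_\infty$. A tour $\pi$ is an order of visit of the cities starting from and returning to $p_0$. A trajectory realizes $\pi$ if it starts and ends at $p_0$ with zero velocity and visits the cities in the order given by $\pi$. The oracle: $\mathrm{oracle}(\pi)$ returns the cost of an optimal (minimum length) trajectory realizing $\pi$. The function $\mathrm{arbitrary\_tour}(P,p_0)$ returns a trivial initial tour, starting and terminating at $p_0$, that can be realized by a trajectory of length $O(nL)$. The function $\mathrm{flip}(\pi,i,j)$ returns the tour obtained from $\pi$ by inverting the segment (subtour) of $\pi$ delimited by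 the cities $i$ and $j$. Algorithm \texttt{FlipTour}: set $\pi_{opt}\leftarrow \mathrm{arbitrary\_tour}(P,p_0)$ and $C_{opt}\leftarrow\mathrm{oracle}(\pi_{opt})$. Then repeat the following round: for each city $i\in P\setminus\{p_0\}$ and each city $j\in P\setminus\{p_0,i\}$, let $\pi_{test}=\mathrm{flip}(\pi_{opt},i,j)$ and $C_{test}=\mathrm{oracle}(\pi_{test})$; if $C_{test}<C_{opt}$, set $\pi_{opt}\leftarrow\pi_{test}$, $C_{opt}\leftarrow C_{test}$ and immediately start a new round. If a round ends without any improvement, return $\pi_{opt}$. The $O(\cdot)$ notation is asymptotic, with $d$ fixed. -}

module Defs where

open import Data.Bool.Base using (if_then_else_)
open import Data.Integer as ℤ using (ℤ; ∣_∣)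
open import Data.List.Base
  using (List; []; _∷_; _++_; break; cartesianProductWith; concat; concatMap;
         head; last; length; map; reverse)
open import Data.List.Extrema.Nat using (max)
open import Data.List.Membership.Propositional using (_∈_)
import Data.List.Membership.DecPropositional as DecMembership
open import Data.List.Properties
  using (++-assoc; ++-identityʳ; span-defn; takeWhile++dropWhile)
open import Data.List.Relation.Binary.Permutation.Propositional
  using (_↭_; prep; ↭-refl; ↭-reflexive; ↭-trans)
open import Data.List.Relation.Binary.Permutation.Propositional.Properties
  using (++⁺ˡ; ++⁺ʳ; ↭-reverse)
open import Data.List.Relation.Binary.Pointwise using (Pointwise)
open import Data.List.Relation.Unary.All using (All)
open import Data.List.Relation.Unary.Linked using (Linked)
open import Data.List.Relation.Unary.Unique.Propositional using (Unique)
open import Data.Maybe.Base using (Maybe; just; nothing)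
open import Data.Nat using (ℕ; suc; _+_; _≤_; _<_; _⊔_; _<?_)
open import Data.Product using (∃-syntax; _×_; _,_; map₂; uncurry)
open import Data.Rational as ℚ using (ℚ; 0ℚ; 1ℚ)
open import Data.Vec.Base as Vec using (Vec; lookup; replicate; zipWith)
open import Data.Vec.Properties using (≡-dec)
import Data.Vec.Relation.Unary.All as VecAll
open import Relation.Binary.Definitions using (DecidableEquality)
open import Relation.Binary.PropositionalEquality using (_≡_; cong; sym; trans)
open import Relation.Nullary using (does)

private
  variable
    d : ℕ

Point : ℕ → Set
Point d = Vec ℤ d

_≟ᵖ_ : DecidableEquality (Point d)
_≟ᵖ_ = ≡-dec ℤ._≟_

_+ᵖ_ _-ᵖ_ : Point d → Point d → Point d
_+ᵖ_ = zipWith ℤ._+_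
_-ᵖ_ = zipWith ℤ._-_

𝟎 : Point d
𝟎 = replicate _ (ℤ.+ 0)

‖_‖∞ : Point d → ℕ
‖ v ‖∞ = Vec.foldr′ _⊔_ 0 (Vec.map ∣_∣ v)

fromℤ : ℤ → ℚ
fromℤ z = z ℚ./ 1

OnSegment : Point d → Point d → Point d → Set
OnSegment {d} a b p = ∃[ t ] (0ℚ ℚ.≤ t) × (t ℚ.≤ 1ℚ) ×
  (∀ i → fromℤ (lookup p i)
           ≡ fromℤ (lookup a i) ℚ.+ t ℚ.* fromℤ (lookup b i ℤ.- lookup a i))

record Config (d : ℕ) : Set where
  constructor ⟨_,_⟩
  field
    pos : Point d
    vel : Point d

open Config public

record Successor (c c′ : Config d) : Set where
  field
    acceleration : VecAll.All (λ z → ∣ z ∣ ≤ 1) (vel c′ -ᵖ vel c)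
    movement     : pos c′ ≡ pos c +ᵖ vel c′

IsTrajectory : List (Config d) → Set
IsTrajectory = Linked Successor

cost : List (Config d) → ℕ
cost = length

previous : Config d → Point d
previous c = pos c -ᵖ vel c

VisitedBy : Config d → Point d → Set
VisitedBy c p = OnSegment (previous c) (pos c) p

-- The cities `ps` are visited, in this order, by the configuration c.  They lie
-- on one segment starting at `previous c`, so every norm orders them alike.
VisitsDuring : Config d → List (Point d) → Set
VisitsDuring c ps = All (VisitedBy c) ps ×
  Linked (λ p q → ‖ p -ᵖ previous c ‖∞ < ‖ q -ᵖ previous c ‖∞) ps

-- Each configuration is assigned the (possibly empty) list of cities whose visit
-- it counts for; a city it passes over need not be in that list.
VisitsInOrder : List (Config d) → List (Point d) → Set
VisitsInOrder T ps =
  ∃[ groups ] Pointwise VisitsDuring T groups × concat groups ≡ ps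

record Input (d : ℕ) : Set where
  field
    cities   : List (Point d)
    distinct : Unique cities
    start    : Point d
    start∈   : start ∈ cities

  n : ℕ
  n = length cities

  L : ℕ
  L = max 0 (cartesianProductWith (λ p q → ‖ p -ᵖ q ‖∞) cities cities)

open Input public using (n; L)

module _ (I : Input d) where
  open Input I using (cities; start)

  -- The tour start, order, start; only the cities strictly in between are listed.
  record Tour : Set where
    constructor tour
    field
      order  : List (Point d)
      isTour : start ∷ order ↭ cities

  -- `ps` lists the cities between the initial and final stay at `start`.
  record Realizes (T : List (Config d)) (ps : List (Point d)) : Set where
    field
      trajectory : IsTrajectory T
      starts     : head T ≡ just ⟨ start , 𝟎 ⟩
      ends       : last T ≡ just ⟨ start , 𝟎 ⟩
      visits     : VisitsInOrder T ps

  record IsOptimal (T : List (Config d)) (ps : List (Point d)) : Set where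
    field
      realizes : Realizes T ps
      minimum  : ∀ T′ → Realizes T′ ps → cost T ≤ cost T′

  IsOracle : (Tour → ℕ) → Set
  IsOracle oracle =
    ∀ π → ∃[ T ] IsOptimal T (Tour.order π) × oracle π ≡ cost T

  LocalOptimum : Tour → Set
  LocalOptimum π = ∃[ T ] IsOptimal T (Tour.order π) ×
    (∀ xs ys zs → Tour.order π ≡ xs ++ ys ++ zs →
     ∀ T′ → Realizes T′ (xs ++ reverse ys ++ zs) → cost T ≤ cost T′)

module _ (i j : Point d) where
  open DecMembership (_≟ᵖ_ {d}) using (_∈?_)

  breakAtEnd : List (Point d) → List (Point d) × List (Point d)
  breakAtEnd = break (_∈? (i ∷ j ∷ []))

  -- Here x is the end of the segment that comes first; `y ∷ post` starts with the
  -- other end.  The other clause is for lists that do not contain both i and j,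
  -- which does not happen for distinct non-starting cities of a tour.
  invertFrom : Point d → List (Point d) × List (Point d) → List (Point d)
  invertFrom x (mid , [])       = x ∷ mid
  invertFrom x (mid , y ∷ post) = reverse (x ∷ mid ++ y ∷ []) ++ post

  invertFirst : List (Point d) → List (Point d)
  invertFirst []       = []
  invertFirst (x ∷ ps) = invertFrom x (breakAtEnd ps)

  -- Inverts the segment delimited by i and j, endpoints included, whichever of
  -- the two comes first.
  flipOrder : List (Point d) → List (Point d)
  flipOrder ps = let (pre , rest) = breakAtEnd ps in pre ++ invertFirst rest

  breakAtEnd-++ : ∀ ps → uncurry _++_ (breakAtEnd ps) ≡ ps
  breakAtEnd-++ ps = trans (cong (uncurry _++_) (span-defn _ ps))
                           (takeWhile++dropWhile _ ps)

  invertFrom-↭ : ∀ x split → invertFrom x split ↭ x ∷ uncurry _++_ split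
  invertFrom-↭ x (mid , [])       = ↭-reflexive (cong (x ∷_) (sym (++-identityʳ mid)))
  invertFrom-↭ x (mid , y ∷ post) = ↭-trans
    (++⁺ʳ post (↭-reverse (x ∷ mid ++ y ∷ [])))
    (↭-reflexive (cong (x ∷_) (++-assoc mid (y ∷ []) post)))

  invertFirst-↭ : ∀ ps → invertFirst ps ↭ ps
  invertFirst-↭ []       = ↭-refl
  invertFirst-↭ (x ∷ ps) = ↭-trans (invertFrom-↭ x (breakAtEnd ps))
    (↭-reflexive (cong (x ∷_) (breakAtEnd-++ ps)))

  flipOrder-↭ : ∀ ps → flipOrder ps ↭ ps
  flipOrder-↭ ps = let (pre , rest) = breakAtEnd ps in
    ↭-trans (++⁺ˡ pre (invertFirst-↭ rest)) (↭-reflexive (breakAtEnd-++ ps))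

module _ {I : Input d} where

  flip : Tour I → Point d → Point d → Tour I
  flip (tour order isTour) i j =
    tour (flipOrder i j order) (↭-trans (prep _ (flipOrder-↭ i j order)) isTour)

-- An order in which the two nested loops of a round may enumerate the cities:
-- i runs through P ∖ {p₀} and, for each i, j runs through P ∖ {p₀ , i}.
record LoopOrder (I : Input d) : Set where
  open Input I using (cities; start)
  field
    outer  : List (Point d)
    outer↭ : start ∷ outer ↭ cities
    inner  : Point d → List (Point d)
    inner↭ : ∀ {i} → i ∈ outer → start ∷ i ∷ inner i ↭ cities

  pairs : List (Point d × Point d)
  pairs = concatMap (λ i → map (i ,_) (inner i)) outer

module _ {I : Input d} (oracle : Tour I → ℕ) where

  -- One round with current tour πopt of cost Copt: the improvement at which the
  -- round is abandoned, if any, and the number of oracle calls made.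
  round : Tour I → ℕ → List (Point d × Point d) → Maybe (Tour I × ℕ) × ℕ
  round πopt Copt []             = nothing , 0
  round πopt Copt ((i , j) ∷ ps) =
    let πtest = flip πopt i j
        Ctest = oracle πtest
    in if does (Ctest <? Copt)
       then just (πtest , Ctest) , 1
       else map₂ suc (round πopt Copt ps)

  module _ (schedule : ℕ → LoopOrder I) where

    -- `Rounds r πopt Copt π k`: the rounds from number r on terminate, returning
    -- π after k oracle calls.  The indices π and k are determined by the others,
    -- and an infinite sequence of rounds has no derivation.
    data Rounds (r : ℕ) (πopt : Tour I) (Copt : ℕ) : Tour I → ℕ → Set where
      stop : ∀ {k} →
             round πopt Copt (LoopOrder.pairs (schedule r)) ≡ (nothing , k) →
             Rounds r πopt Copt πopt k
      next : ∀ {π′ C′ k π m} →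
             round πopt Copt (LoopOrder.pairs (schedule r)) ≡ (just (π′ , C′) , k) →
             Rounds (suc r) π′ C′ π m →
             Rounds r πopt Copt π (k + m)

    data FlipTour (initial : Tour I) : Tour I → ℕ → Set where
      run : ∀ {π k} → Rounds 0 initial (oracle initial) π k →
            FlipTour initial π (suc k)

{-# OPTIONS --safe #-}

-- Every new round starts with a strictly cheaper tour, and costs are positive, so
-- an initial tour of cost C leads to at most C rounds; each round makes fewer than
-- n² oracle calls, and C ≤ K₀ n L.  A subtour of length at most one is its own
-- inverse, and any longer one is delimited by two distinct non-starting cities, so
-- the round without improvement has tested every inversion.
module Submission where

open import Defs
open import Data.Nat using (ℕ; _*_; _^_; _≤_)
open import Data.Product using (∃-syntax; _×_)

open import Data.List.Base
  using (List; []; _∷_; _++_; [_]; _∷ʳ_; break; concatMap; initLast; InitLast;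
         length; map; reverse; _∷ʳ′_)
import Data.List.Membership.DecPropositional as DecMembership
open import Data.List.Membership.Propositional using (_∈_; _∉_)
open import Data.List.Membership.Propositional.Properties
  using (∈-++⁺ˡ; ∈-++⁺ʳ; ∈-concatMap⁺; ∈-map⁺)
open import Data.List.Properties using (++-assoc; length-++; length-map)
open import Data.List.Relation.Binary.Permutation.Propositional
  using (_↭_; ↭-sym; ↭-trans; ↭⇒↭ₛ)
open import Data.List.Relation.Binary.Permutation.Propositional.Properties
  using (drop-∷; ∈-resp-↭; ↭-length)
import Data.List.Relation.Binary.Permutation.Setoid.Properties as Permutationₛ
open import Data.List.Relation.Unary.All as All using (All; []; _∷_)
open import Data.List.Relation.Unary.AllPairs using (AllPairs; []; _∷_)
open import Data.List.Relation.Unary.Any as Any using (here; there)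
open import Data.List.Relation.Unary.Unique.Propositional using (Unique)
open import Data.Maybe.Base using (just; nothing)
open import Data.Nat using (suc; _+_; _<_; _<?_; z≤n; s≤s; >-nonZero)
open import Data.Nat.Induction using (<-wellFounded)
open import Data.Nat.Properties
  using (+-mono-≤; +-mono-<; *-monoˡ-≤; m≤n*m; m≤n+m; m<n+m; ≤-<-trans; ≮⇒≥;
         module ≤-Reasoning)
open import Data.Nat.Tactic.RingSolver using (solve-∀)
open import Data.Product using (_,_; map₂)
open import Function using (_∘_)
open import Induction.WellFounded using (Acc; acc)
open import Level using (Level)
open import Relation.Binary.Core using (Rel)
open import Relation.Binary.PropositionalEquality
  using (_≡_; _≢_; refl; sym; trans; cong; subst; setoid)
open import Relation.Nullary using (¬_; yes; no; contradiction)
open import Relation.Nullary.Decidable using (dec-true; dec-false)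
open import Relation.Unary using (Pred; Decidable)

private
  variable
    a b p r : Level
    A : Set a
    B : Set b
    d : ℕ

-- Lists: pairwise relations, first matches and lengths

AllPairs-++⁻ : ∀ {R : Rel A r} xs {ys} → AllPairs R (xs ++ ys) →
               All (λ x → All (R x) ys) xs × AllPairs R ys
AllPairs-++⁻ []       Rys          = [] , Rys
AllPairs-++⁻ (x ∷ xs) (Rx ∷ Rxsys) =
  let (Rxs , Rys) = AllPairs-++⁻ xs Rxsys
  in All.tabulate (λ y∈ys → All.lookup Rx (∈-++⁺ʳ xs y∈ys)) ∷ Rxs , Rys

Unique-resp-↭ : {xs ys : List A} → xs ↭ ys → Unique xs → Unique ys
Unique-resp-↭ {A = A} xs↭ys = Permutationₛ.Unique-resp-↭ (setoid A) (↭⇒↭ₛ xs↭ys)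

break-++ : ∀ {P : Pred A p} (P? : Decidable P) {xs y ys} →
           All (¬_ ∘ P) xs → P y → break P? (xs ++ y ∷ ys) ≡ (xs , y ∷ ys)
break-++ P? {y = y} [] py
  rewrite dec-true (P? y) py = refl
break-++ P? {xs = x ∷ xs} {y} {ys} (¬px ∷ ¬pxs) py
  rewrite dec-false (P? x) ¬px | break-++ P? {ys = ys} ¬pxs py = refl

length-concatMap-≤ : ∀ {m} (f : A → List B) xs →
                     (∀ {x} → x ∈ xs → length (f x) ≤ m) →
                     length (concatMap f xs) ≤ length xs * m
length-concatMap-≤ f []       f≤ = z≤n
length-concatMap-≤ f (x ∷ xs) f≤
  rewrite length-++ (f x) {concatMap f xs} =
  +-mono-≤ (f≤ (here refl)) (length-concatMap-≤ f xs (f≤ ∘ there))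

-- Flipping as inversion of a contiguous segment

module _ {i j : Point d} where
  open DecMembership (_≟ᵖ_ {d}) using (_∈?_)

  -- The first break stops at `i` because no entry of `xs` is an end, and the second at `j` because
  -- no entry of `ys` is.
  flipOrder-invert-∉ : ∀ {xs ys} zs →
                       All (_∉ i ∷ j ∷ []) xs → All (_∉ i ∷ j ∷ []) ys →
                       flipOrder i j (xs ++ (i ∷ ys ∷ʳ j) ++ zs)
                         ≡ xs ++ reverse (i ∷ ys ∷ʳ j) ++ zs
  flipOrder-invert-∉ {xs} {ys} zs xs∌ ys∌
    rewrite ++-assoc ys [ j ] zs
          | break-++ (_∈? (i ∷ j ∷ [])) {ys = ys ++ j ∷ zs} xs∌ (here refl)
          | break-++ (_∈? (i ∷ j ∷ [])) {ys = zs} ys∌ (there (here refl))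
    = refl

-- Distinctness keeps a further copy of `i` or `j` out of `xs` and `ys`, so neither break can stop
-- early.
flipOrder-invert : ∀ (xs : List (Point d)) i ys j zs →
                   Unique (xs ++ (i ∷ ys ∷ʳ j) ++ zs) →
                   flipOrder i j (xs ++ (i ∷ ys ∷ʳ j) ++ zs)
                     ≡ xs ++ reverse (i ∷ ys ∷ʳ j) ++ zs
flipOrder-invert xs i ys j zs unique
  with xs≢ , i≢ ∷ unique′ ← AllPairs-++⁻ xs unique
  with ys≢ , _ ← AllPairs-++⁻ ys (subst Unique (++-assoc ys [ j ] zs) unique′) =
  flipOrder-invert-∉ zs
    (All.map (λ where
      x≢ (here x≡i)         → All.lookup x≢ (here refl) x≡i
      x≢ (there (here x≡j)) → All.lookup x≢ (there (∈-++⁺ˡ (∈-++⁺ʳ ys (here refl)))) x≡j)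
      xs≢)
    (All.tabulate λ where
      y∈ys (here y≡i)         → All.lookup i≢ (∈-++⁺ˡ (∈-++⁺ˡ y∈ys)) (sym y≡i)
      y∈ys (there (here y≡j)) → All.lookup (All.lookup ys≢ y∈ys) (here refl) y≡j)

-- The pairs tested in one round

module _ {I : Input d} where
  open Input I using (distinct; start)

  order-unique : (π : Tour I) → Unique (start ∷ Tour.order π)
  order-unique π = Unique-resp-↭ (↭-sym (Tour.isTour π)) distinct

  module _ (loop : LoopOrder I) where
    open LoopOrder loop

    -- There are `n I` minus one rows, each of length at most `n I`. The strictness later pays for
    -- the initial oracle call.
    length-pairs< : length pairs < n I * n I
    length-pairs< = begin-strict
      length pairs              ≤⟨ length-concatMap-≤ _ outer length-row≤ ⟩
      length outer * n I        <⟨ m<n+m (length outer * n I) 0<n ⟩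
      suc (length outer) * n I  ≡⟨ cong (_* n I) (↭-length outer↭) ⟩
      n I * n I                 ∎
      where
      open ≤-Reasoning

      0<n : 0 < n I
      0<n = subst (0 <_) (↭-length outer↭) (s≤s z≤n)

      length-row≤ : ∀ {i} → i ∈ outer → length (map (i ,_) (inner i)) ≤ n I
      length-row≤ {i} i∈ = begin
        length (map (i ,_) (inner i))  ≡⟨ length-map (i ,_) (inner i) ⟩
        length (inner i)               ≤⟨ m≤n+m _ 2 ⟩
        2 + length (inner i)           ≡⟨ ↭-length (inner↭ i∈) ⟩
        n I                            ∎

    -- Tour and loops permute the same cities, so cancelling the start puts `i` in `outer`;
    -- cancelling it again puts `j` in `i ∷ inner i`.
    ∈-pairs : (π : Tour I) → ∀ {i j} → i ∈ Tour.order π → j ∈ Tour.order π →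
              i ≢ j → (i , j) ∈ pairs
    ∈-pairs π {i} {j} i∈π j∈π i≢j =
      ∈-concatMap⁺ _ (Any.map (λ { refl → ∈-map⁺ (i ,_) j∈inner }) i∈outer)
      where
      i∈outer : i ∈ outer
      i∈outer = ∈-resp-↭ (drop-∷ (↭-trans (Tour.isTour π) (↭-sym outer↭))) i∈π

      j∈inner : j ∈ inner i
      j∈inner with ∈-resp-↭ (drop-∷ (↭-trans (Tour.isTour π) (↭-sym (inner↭ i∈outer)))) j∈π
      ... | here j≡i = contradiction (sym j≡i) i≢j
      ... | there j∈ = j∈

  -- Rounds and termination

  module _ (oracle : Tour I → ℕ) where

    NoImprovement : Tour I → List (Point d × Point d) → Set
    NoImprovement π = All λ (i , j) → oracle π ≤ oracle (flip π i j)

    -- The equations are kept because the constructors of `Rounds` ask for them. Recording the new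
    -- cost as `oracle π′` maintains the invariant that the stored cost is that of the current tour.
    data RoundOutcome (π : Tour I) (ps : List (Point d × Point d)) : Set where
      unimproved : ∀ {k} → round oracle π (oracle π) ps ≡ (nothing , k) →
                   NoImprovement π ps → k ≤ length ps → RoundOutcome π ps
      improved   : ∀ {π′ k} → round oracle π (oracle π) ps ≡ (just (π′ , oracle π′) , k) →
                   oracle π′ < oracle π → k ≤ length ps → RoundOutcome π ps

    module _ (π : Tour I) {i j : Point d} (ps : List (Point d × Point d)) where

      round-here : oracle (flip π i j) < oracle π →
                   round oracle π (oracle π) ((i , j) ∷ ps)
                     ≡ (just (flip π i j , oracle (flip π i j)) , 1)
      round-here better
        rewrite dec-true (oracle (flip π i j) <? oracle π) better = refl

      round-there : ¬ oracle (flip π i j) < oracle π →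
                    round oracle π (oracle π) ((i , j) ∷ ps)
                      ≡ map₂ suc (round oracle π (oracle π) ps)
      round-there ¬better
        rewrite dec-false (oracle (flip π i j) <? oracle π) ¬better = refl

    roundOutcome : ∀ π ps → RoundOutcome π ps
    roundOutcome π []             = unimproved refl [] z≤n
    roundOutcome π ((i , j) ∷ ps) with oracle (flip π i j) <? oracle π
    ... | yes better = improved (round-here π ps better) better (s≤s z≤n)
    ... | no ¬better with roundOutcome π ps
    ...   | unimproved eq none k≤ =
      unimproved (trans (round-there π ps ¬better) (cong (map₂ suc) eq))
                 (≮⇒≥ ¬better ∷ none) (s≤s k≤)
    ...   | improved eq better k≤ =
      improved (trans (round-there π ps ¬better) (cong (map₂ suc) eq)) better (s≤s k≤)

    module _ (oracle>0 : ∀ π → 0 < oracle π) (schedule : ℕ → LoopOrder I) where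

      -- Well-founded recursion on the cost of the current tour. The loop order of the last round is
      -- returned as the witness of what was tested against the final tour.
      search : ∀ r π → Acc _<_ (oracle π) →
               ∃[ π′ ] ∃[ k ] Rounds oracle schedule r π (oracle π) π′ k ×
                 (∃[ loop ] NoImprovement π′ (LoopOrder.pairs loop)) ×
                 k < oracle π * (n I * n I)
      search r π (acc rs) with roundOutcome π (LoopOrder.pairs (schedule r))
      ... | unimproved {k} eq none k≤ = π , k , Rounds.stop eq , (schedule r , none) , (begin-strict
        k                                      ≤⟨ k≤ ⟩
        length (LoopOrder.pairs (schedule r))  <⟨ length-pairs< (schedule r) ⟩
        -- A positive cost leaves room for the final, unsuccessful round.
        n I * n I                              ≤⟨ m≤n*m _ (oracle π) ⦃ >-nonZero (oracle>0 π) ⦄ ⟩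
        oracle π * (n I * n I)                 ∎)
        where open ≤-Reasoning
      ... | improved {π₁} {k} eq better k≤
        with π′ , m , rounds , none , m< ← search (suc r) π₁ (rs better) =
        π′ , k + m , Rounds.next eq rounds , none , (begin-strict
          k + m                                <⟨ +-mono-< (≤-<-trans k≤ (length-pairs< (schedule r))) m< ⟩
          -- The left side is `suc (oracle π₁) * (n I * n I)` unfolded, and `better` says
          -- `suc (oracle π₁) ≤ oracle π`.
          n I * n I + oracle π₁ * (n I * n I)  ≤⟨ *-monoˡ-≤ (n I * n I) better ⟩
          oracle π * (n I * n I)               ∎)
        where open ≤-Reasoning

    -- From oracle values to local optimality

    module _ (isOracle : IsOracle I oracle) where
      open IsOptimal
      open Realizes

      oracle≤cost : ∀ π {T} → Realizes I T (Tour.order π) → oracle π ≤ cost T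
      oracle≤cost π {T} real with _ , opt , eq ← isOracle π =
        subst (_≤ cost T) (sym eq) (minimum opt T real)

      -- A realizing trajectory has a first configuration, so it is not empty.
      oracle>0 : ∀ π → 0 < oracle π
      oracle>0 π with isOracle π
      ... | []    , opt , _  = contradiction (starts (realizes opt)) λ ()
      ... | _ ∷ _ , _   , eq = subst (0 <_) (sym eq) (s≤s z≤n)

      noImprovement⇒localOptimum : ∀ π (loop : LoopOrder I) →
        NoImprovement π (LoopOrder.pairs loop) → LocalOptimum I π
      noImprovement⇒localOptimum π loop none with T , opt , eq ← isOracle π =
        T , opt , λ xs ys zs → invert xs ys zs (initLast ys)
        where
        invert : ∀ xs ys zs → InitLast ys → Tour.order π ≡ xs ++ ys ++ zs →
                 ∀ T′ → Realizes I T′ (xs ++ reverse ys ++ zs) → cost T ≤ cost T′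
        -- For at most one city `reverse` computes to the segment itself, so `T′` realizes `π` and
        -- optimality of `T` applies.
        invert xs _ zs [] π≡ T′ real =
          minimum opt T′ (subst (Realizes I T′) (sym π≡) real)
        invert xs _ zs ([] ∷ʳ′ _) π≡ T′ real =
          minimum opt T′ (subst (Realizes I T′) (sym π≡) real)
        -- Here `T′` realizes `flip π i j`, a tour that the last round compared with `π`.
        invert xs _ zs ((i ∷ ys) ∷ʳ′ j) π≡ T′ real = begin
          cost T               ≡⟨ eq ⟨
          oracle π             ≤⟨ All.lookup none (∈-pairs loop π i∈ j∈ i≢j) ⟩
          oracle (flip π i j)  ≤⟨ oracle≤cost (flip π i j) (subst (Realizes I T′) (sym inverted) real) ⟩
          cost T′              ∎
          where
          open ≤-Reasoning

          unique : Unique (xs ++ (i ∷ ys ∷ʳ j) ++ zs)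
          unique with _ ∷ u ← order-unique π = subst Unique π≡ u

          inverted : flipOrder i j (Tour.order π) ≡ xs ++ reverse (i ∷ ys ∷ʳ j) ++ zs
          inverted = trans (cong (flipOrder i j) π≡) (flipOrder-invert xs i ys j zs unique)

          j∈tail : j ∈ (ys ∷ʳ j) ++ zs
          j∈tail = ∈-++⁺ˡ (∈-++⁺ʳ ys (here refl))

          i∈ : i ∈ Tour.order π
          i∈ = subst (i ∈_) (sym π≡) (∈-++⁺ʳ xs (here refl))

          j∈ : j ∈ Tour.order π
          j∈ = subst (j ∈_) (sym π≡) (∈-++⁺ʳ xs (there j∈tail))

          i≢j : i ≢ j
          i≢j with _ , i≢ ∷ _ ← AllPairs-++⁻ xs unique = All.lookup i≢ j∈tail

theorem4 : ∀ (d : ℕ) (arbitraryTour : (I : Input d) → Tour I) →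
    (∃[ K₀ ] ∀ (I : Input d) → 2 ≤ n I →
    ∃[ T ] Realizes I T (Tour.order (arbitraryTour I)) × cost T ≤ K₀ * (n I * L I)) →
    ∃[ K ] ∀ (I : Input d) (oracle : Tour I → ℕ) → IsOracle I oracle →
    ∀ (schedule : ℕ → LoopOrder I) →
    ∃[ π ] ∃[ calls ]
    FlipTour oracle schedule (arbitraryTour I) π calls ×
    LocalOptimum I π ×
    (2 ≤ n I → calls ≤ K * (n I ^ 3 * L I))
theorem4 d arbitraryTour (K₀ , realizable) = K₀ , λ I oracle isOracle schedule →
  let π₀ = arbitraryTour I
      (π , k , rounds , (loop , none) , k<) =
        search oracle (oracle>0 oracle isOracle) schedule 0 π₀ (<-wellFounded (oracle π₀))
  in π , suc k , run rounds , noImprovement⇒localOptimum oracle isOracle π loop none ,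
     -- With a single city `L I` is 0 while the initial call still counts, so the bound starts at
     -- two cities.
     λ 2≤n → let (T , real , cost≤) = realizable I 2≤n in begin
       -- The strict bound on `k` absorbs the initial oracle call.
       suc k                              ≤⟨ k< ⟩
       oracle π₀ * (n I * n I)            ≤⟨ *-monoˡ-≤ (n I * n I) (oracle≤cost oracle isOracle π₀ real) ⟩
       cost T * (n I * n I)               ≤⟨ *-monoˡ-≤ (n I * n I) cost≤ ⟩
       K₀ * (n I * L I) * (n I * n I)     ≡⟨ regroup K₀ (n I) (L I) ⟩
       K₀ * (n I ^ 3 * L I)               ∎
  where
  open ≤-Reasoning

  -- The cube is written out in the form to which `m ^ 3` computes.
  regroup : ∀ K m l → K * (m * l) * (m * m) ≡ K * (m * (m * (m * 1)) * l)
  regroup = solve-∀
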